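{- Let $\mathcal{P}$ be a reliable graph property with $d(\mathcal{P})=r$, let $G$ be a graph, and let $(X,H)$ be a $\mathcal{P}$-critical cover of $G$. Then the following statements hold: (a) $d_G(v)\ge r|X_v|$ for all $v\in V(G)$. (b) Let $v$ be a vertex of $G$ such that $d_G(v)=r|X_v|$, and let $T$ be a $(\mathcal{P},v)$-transversal of $(X,H)$. Moreover, for $x\in X_v$, let $H_x=H[T\cup\{x\}]$ and $d_x=d_{H_x}(x)$. Then $d_x=r$ for all $x\in X_v$ and $d_G(v)=\sum_{x\in X_v}d_x$.
   Context: Graphs are finite, undirected, may have multiple edges, no loops. $\mu_G(u,v)$ is the number of edges joining $u$ and $v$; $d_G(v)$ is the number of edges incident with $v$; $\delta(G)$ is the minimum degree. A cover of $G$ is a pair $(X,H)$ where $H$ is a graph and $X$ assigns to each $v\in V(G)$ a set $X_v\subseteq V(H)$ such that the sets $X_v$ are pairwise disjoint, $V(H)=\bigcup_v X_v$, each $X_v$ is independent in $H$, and for distinct $u,v\in V(G)$ the set $E_H(X_u,X_v)$ of edges of $H$ between $X_u$ and $X_v$ is the union of $\mu_G(u,v)$ (possibly empty) matchings of $H$. A transversal of $(X,H)$ is a set $T\subseteq V(H)$ with $|T\cap X_v|=1$ for all $v\in V(G)$; a partial transversal satisfies $|T\cap X_v|\le 1$ for all $v$; $\mathrm{dom}(T:G)=\{v\in V(G): X_v\cap T\neq\varnothing\}$. A graph property is a class of graphs closed under isomorphism. It is non-trivial if it contains a non-empty graph but not all graphs; hereditary if closed under induced subgraphs; additive if closed under disjoint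 unions; reliable if non-trivial, hereditary and additive. For non-trivial hereditary $\mathcal{P}$: $\mathrm{CR}(\mathcal{P})$ is the class of graphs $G\notin\mathcal{P}$ with $G-v\in\mathcal{P}$ for all $v\in V(G)$, and $d(\mathcal{P})=\min\{\delta(G): G\in\mathrm{CR}(\mathcal{P})\}$. A $\mathcal{P}$-transversal of $(X,H)$ is a transversal $T$ with $H[T]\in\mathcal{P}$. A $(\mathcal{P},v)$-transversal of $(X,H)$ is a partial transversal $T$ with $\mathrm{dom}(T:G)=V(G)\setminus\{v\}$ and $H[T]\in\mathcal{P}$. The cover $(X,H)$ of $G$ is $\mathcal{P}$-critical if it has no $\mathcal{P}$-transversal, but for every $v\in V(G)$ it has a $(\mathcal{P},v)$-transversal. -}

module Defs where

open import Level using (Level) renaming (suc to lsuc)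
open import Data.Nat.Base using (ℕ; _+_; _≤_; NonZero)
open import Data.Fin.Base using (Fin; zero; suc; _↑ˡ_; _↑ʳ_; splitAt)
open import Data.Fin.Properties using (_≟_; ↑ˡ-injective; ↑ʳ-injective)
open import Data.Fin.Subset using (Subset; inside; outside; _∈_; _∩_; _∪_; ∁; ⁅_⁆; ∣_∣; Nonempty; Empty)
open import Data.Fin.Subset.Properties using (_∈?_; nonempty?; x∈⁅x⁆; q⊆p∪q)
open import Data.Product.Base using (∃; _×_; _,_; proj₁; proj₂)
open import Data.Sum.Base using (_⊎_; inj₁; inj₂; [_,_]′)
open import Data.Vec.Base using (_∷_; tabulate; here; there; sum)
open import Data.Vec.Properties using ([]=⇒lookup; lookup∘tabulate)
open import Function.Base using (_∘_)
open import Function.Bundles using (_⇔_; _↔_; Inverse)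
open import Relation.Binary.PropositionalEquality using (_≡_; _≢_; refl; sym; trans; cong)
open import Relation.Nullary using (¬_; yes; no; does)
open import Relation.Nullary.Decidable using (_×-dec_; _⊎-dec_)
open import Relation.Unary using (Pred; Decidable)

private
  variable
    ℓ : Level
    n : ℕ

comprehension : {P : Pred (Fin n) ℓ} → Decidable P → Subset n
comprehension P? = tabulate (does ∘ P?)

element : (S : Subset n) → Fin ∣ S ∣ → Fin n
element (inside  ∷ S) zero    = zero
element (inside  ∷ S) (suc i) = suc (element S i)
element (outside ∷ S) i       = suc (element S i)

index : {S : Subset n} {x : Fin n} → x ∈ S → Fin ∣ S ∣
index {S = inside  ∷ S} here      = zero
index {S = inside  ∷ S} (there p) = suc (index p)
index {S = outside ∷ S} (there p) = index p

element∈ : (S : Subset n) (i : Fin ∣ S ∣) → element S i ∈ S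
element∈ (inside  ∷ S) zero    = here
element∈ (inside  ∷ S) (suc i) = there (element∈ S i)
element∈ (outside ∷ S) i       = there (element∈ S i)

element-index : {S : Subset n} {x : Fin n} (p : x ∈ S) → element S (index p) ≡ x
element-index {S = inside  ∷ S} here      = refl
element-index {S = inside  ∷ S} (there p) = cong suc (element-index p)
element-index {S = outside ∷ S} (there p) = cong suc (element-index p)

index-injective : {S : Subset n} {x y : Fin n} (p : x ∈ S) (q : y ∈ S) → index p ≡ index q → x ≡ y
index-injective {S = S} p q eq =
  trans (sym (element-index p)) (trans (cong (element S) eq) (element-index q))

∈-comprehension⁻ : {P : Pred (Fin n) ℓ} (P? : Decidable P) {x : Fin n} → x ∈ comprehension P? → P x
∈-comprehension⁻ P? {x} x∈ with P? x | trans (sym (lookup∘tabulate (does ∘ P?) x)) ([]=⇒lookup x∈)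
... | yes px | _  = px
... | no  _  | ()

∑ : (S : Subset n) → (Fin n → ℕ) → ℕ
∑ S f = sum (tabulate (f ∘ element S))

IsMinimum : Pred ℕ ℓ → ℕ → Set ℓ
IsMinimum A m = A m × (∀ k → A k → m ≤ k)

-- Edges are objects in their own right, so parallel edges are distinct.
-- The order of the two ends of an edge carries no meaning: everything
-- below refers to the ends only through the symmetric relations Joins
-- and Incident, or requires a property of both ends.

record Graph : Set where
  field
    #V #E     : ℕ
    end₁ end₂ : Fin #E → Fin #V
    loopless  : ∀ e → end₁ e ≢ end₂ e

  V E : Set
  V = Fin #V
  E = Fin #E

  Joins : E → V → V → Set
  Joins e u v = (end₁ e ≡ u × end₂ e ≡ v) ⊎ (end₁ e ≡ v × end₂ e ≡ u)

  joins? : ∀ u v → Decidable (λ e → Joins e u v)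
  joins? u v e = ((end₁ e ≟ u) ×-dec (end₂ e ≟ v)) ⊎-dec ((end₁ e ≟ v) ×-dec (end₂ e ≟ u))

  Incident : V → E → Set
  Incident v e = end₁ e ≡ v ⊎ end₂ e ≡ v

  incident? : ∀ v → Decidable (Incident v)
  incident? v e = (end₁ e ≟ v) ⊎-dec (end₂ e ≟ v)

  μ : V → V → ℕ
  μ u v = ∣ comprehension (joins? u v) ∣

  deg : V → ℕ
  deg v = ∣ comprehension (incident? v) ∣

  IsMinDegree : ℕ → Set
  IsMinDegree = IsMinimum (λ k → ∃ λ v → deg v ≡ k)

  Independent : Subset #V → Set
  Independent S = ∀ {x y} e → x ∈ S → y ∈ S → ¬ Joins e x y

  IsMatching : Subset #E → Set
  IsMatching M = ∀ {e f} v → e ∈ M → f ∈ M → Incident v e → Incident v f → e ≡ f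

  Between : Subset #V → Subset #V → E → Set
  Between A B e = ∃ λ x → ∃ λ y → x ∈ A × y ∈ B × Joins e x y

  Within : Subset #V → E → Set
  Within S e = end₁ e ∈ S × end₂ e ∈ S

  within? : ∀ S → Decidable (Within S)
  within? S e = (end₁ e ∈? S) ×-dec (end₂ e ∈? S)

open Graph

-- The vertex i of G [ S ] stands for the vertex element S i of G, and a
-- vertex x ∈ S of G becomes the vertex index x∈S of G [ S ].

infix 30 _[_]
_[_] : (G : Graph) → Subset (#V G) → Graph
G [ S ] = record
  { #V       = ∣ S ∣
  ; #E       = ∣ F ∣
  ; end₁     = λ i → index (proj₁ (ends∈S i))
  ; end₂     = λ i → index (proj₂ (ends∈S i))
  ; loopless = λ i eq → loopless G (element F i)
      (index-injective (proj₁ (ends∈S i)) (proj₂ (ends∈S i)) eq)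
  }
  where
  F : Subset (#E G)
  F = comprehension (within? G S)

  ends∈S : ∀ i → Within G S (element F i)
  ends∈S i = ∈-comprehension⁻ (within? G S) (element∈ F i)

infixl 20 _-ᵛ_
_-ᵛ_ : (G : Graph) → V G → Graph
G -ᵛ v = G [ ∁ ⁅ v ⁆ ]

infixr 20 _⊎ᵍ_
_⊎ᵍ_ : Graph → Graph → Graph
G ⊎ᵍ K = record
  { #V       = #V G + #V K
  ; #E       = #E G + #E K
  ; end₁     = λ e → end (end₁ G) (end₁ K) (splitAt (#E G) e)
  ; end₂     = λ e → end (end₂ G) (end₂ K) (splitAt (#E G) e)
  ; loopless = λ e → distinct (splitAt (#E G) e)
  }
  where
  end : (E G → V G) → (E K → V K) → E G ⊎ E K → Fin (#V G + #V K)
  end f g = [ (λ e → f e ↑ˡ #V K) , (λ e → #V G ↑ʳ g e) ]′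

  distinct : ∀ s → end (end₁ G) (end₁ K) s ≢ end (end₂ G) (end₂ K) s
  distinct (inj₁ e) eq = loopless G e (↑ˡ-injective (#V K) _ _ eq)
  distinct (inj₂ e) eq = loopless K e (↑ʳ-injective (#V G) _ _ eq)

infix 4 _≅_
record _≅_ (G K : Graph) : Set where
  field
    onV       : V G ↔ V K
    onE       : E G ↔ E K
    preserves : ∀ e u v → Joins G e u v →
                Joins K (Inverse.to onE e) (Inverse.to onV u) (Inverse.to onV v)

record GraphProperty (ℓ : Level) : Set (lsuc ℓ) where
  field
    Has      : Graph → Set ℓ
    ≅-closed : ∀ {G K} → G ≅ K → Has G → Has K

infix 4 _∈ᵖ_ _∉ᵖ_
_∈ᵖ_ _∉ᵖ_ : Graph → GraphProperty ℓ → Set ℓ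
G ∈ᵖ P = GraphProperty.Has P G
G ∉ᵖ P = ¬ (G ∈ᵖ P)

NonTrivial Hereditary Additive : GraphProperty ℓ → Set ℓ
NonTrivial P = (∃ λ G → NonZero (#V G) × G ∈ᵖ P) × ¬ (∀ G → G ∈ᵖ P)
Hereditary P = ∀ G (S : Subset (#V G)) → G ∈ᵖ P → G [ S ] ∈ᵖ P
Additive   P = ∀ G K → G ∈ᵖ P → K ∈ᵖ P → G ⊎ᵍ K ∈ᵖ P

record Reliable (P : GraphProperty ℓ) : Set ℓ where
  field
    nonTrivial : NonTrivial P
    hereditary : Hereditary P
    additive   : Additive P

CR : GraphProperty ℓ → Graph → Set ℓ
CR P G = G ∉ᵖ P × (∀ v → G -ᵛ v ∈ᵖ P)

-- d(P) = r as a relation: that the minimum exists is part of the hypothesis.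
d[_]≔_ : GraphProperty ℓ → ℕ → Set ℓ
d[ P ]≔ r = IsMinimum (λ k → ∃ λ G → CR P G × IsMinDegree G k) r

record Cover (G : Graph) : Set where
  field
    H           : Graph
    X           : V G → Subset (#V H)
    disjoint    : ∀ u v → u ≢ v → Empty (X u ∩ X v)
    covering    : ∀ x → ∃ λ v → x ∈ X v
    independent : ∀ v → Independent H (X v)
    matchings   : ∀ u v → u ≢ v →
                  ∃ λ (M : Fin (μ G u v) → Subset (#E H)) →
                    (∀ i → IsMatching H (M i)) ×
                    (∀ e → Between H (X u) (X v) e ⇔ (∃ λ i → e ∈ M i))

  IsTransversal : Subset (#V H) → Set
  IsTransversal T = ∀ v → ∣ T ∩ X v ∣ ≡ 1

  IsPartialTransversal : Subset (#V H) → Set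
  IsPartialTransversal T = ∀ v → ∣ T ∩ X v ∣ ≤ 1

  dom : Subset (#V H) → Subset (#V G)
  dom T = comprehension (λ v → nonempty? (X v ∩ T))

  IsTransversalFor : GraphProperty ℓ → Subset (#V H) → Set ℓ
  IsTransversalFor P T = IsTransversal T × H [ T ] ∈ᵖ P

  -- (P,v)-transversals
  IsTransversalForAvoiding : GraphProperty ℓ → V G → Subset (#V H) → Set ℓ
  IsTransversalForAvoiding P v T =
    IsPartialTransversal T × dom T ≡ ∁ ⁅ v ⁆ × H [ T ] ∈ᵖ P

  IsCritical : GraphProperty ℓ → Set ℓ
  IsCritical P = ¬ (∃ λ T → IsTransversalFor P T) ×
                 (∀ v → ∃ λ T → IsTransversalForAvoiding P v T)

  -- The degree of x in H[T ∪ {x}].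
  degWith : Subset (#V H) → V H → ℕ
  degWith T x = deg (H [ T ∪ ⁅ x ⁆ ]) (index (q⊆p∪q T ⁅ x ⁆ (x∈⁅x⁆ x)))

{-# OPTIONS --safe #-}

-- Let T be a (P,v)-transversal and x ∈ X_v. The graph H_x = H[T ∪ {x}] is
-- not in P whereas H_x − x is, so every minimal induced subgraph of H_x
-- outside P contains x; being critical, it has minimum degree at least r,
-- hence d_x ≥ r. On the other hand an edge of H from X_v to the vertex of T in
-- X_u lies in one of the μ(v,u) matchings, and no two such edges lie in
-- the same one since they meet in T; so the d_x add up to at most d_G(v).
-- Both parts compare r|X_v| ≤ ∑ d_x ≤ d_G(v).

module Submission where

open import Defs
open import Level using (Level)
open import Data.Nat.Base using (ℕ; zero; suc; s≤s⁻¹; z≤n; _*_; _≤_; _<_; _≥_)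
open import Data.Nat.Properties using (≤-refl; ≤-reflexive; ≤-trans; ≤-antisym; ≤⇒≯; ≮⇒≥; +-mono-≤; +-monoˡ-≤; +-monoʳ-≤; +-cancelˡ-≤; +-cancelʳ-≤; *-comm)
open import Data.Fin.Base using (Fin; zero; suc; _↑ˡ_; _↑ʳ_; splitAt)
open import Data.Fin.Properties using (_≟_; any?; suc-injective; join-splitAt; injective⇒≤; sequence)
open import Data.Fin.Subset using (Subset; inside; outside; _∈_; _∉_; _∩_; _∪_; ∁; ⁅_⁆; ∣_∣)
open import Data.Fin.Subset.Properties using (x∈⁅x⁆; x∈⁅y⁆⇒x≡y; x≢y⇒x∉⁅y⁆; ∣⁅x⁆∣≡1; p⊆q⇒∣p∣≤∣q∣; p⊂q⇒∣p∣<∣q∣; ∣⊤∣≡n; ∈⊤; x∈p⇒x∉∁p; x∈∁p⇒x∉p; x∉p⇒x∈∁p; x∈p∩q⁺; x∈p∩q⁻; x∈p∪q⁺; x∈p∪q⁻; q⊆p∪q; nonempty?)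
open import Data.List.Base using (allFin)
open import Data.List.Extrema.Nat using (argmin; f[argmin]≤f[xs])
open import Data.List.Membership.Propositional.Properties using (∈-allFin)
import Data.List.Relation.Unary.All as All
open import Data.Product.Base using (Σ; ∃; _×_; _,_; proj₁; proj₂)
open import Data.Sum.Base using (_⊎_; inj₁; inj₂; [_,_]′; swap)
open import Data.Vec.Base using (_∷_; tabulate; sum)
open import Data.Vec.Properties using (lookup⇒[]=; lookup∘tabulate)
open import Effect.Monad using (RawMonad)
open import Function.Base using (_∘_)
open import Function.Bundles using (Equivalence; _↔_; mk↔ₛ′)
open import Function.Definitions using (Injective)
open import Relation.Binary.PropositionalEquality using (_≡_; _≢_; refl; sym; trans; cong; subst; subst₂)
open import Relation.Nullary using (¬_; yes; no; does; contradiction)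
open import Relation.Nullary.Decidable using (dec-true)
open import Relation.Nullary.Negation using (¬¬-Monad)
open import Relation.Unary using (Pred; Decidable)
open Graph
open Cover

private
  variable
    ℓ : Level
    m n : ℕ
    G K L : Graph

-- Finite sets

element-injective : (S : Subset n) → Injective _≡_ _≡_ (element S)
element-injective (inside  ∷ S) {zero}  {zero}  eq   = refl
element-injective (inside  ∷ S) {suc i} {suc j} eq   =
  cong suc (element-injective S (suc-injective eq))
element-injective (outside ∷ S) eq = element-injective S (suc-injective eq)

∈-comprehension⁺ : {P : Pred (Fin n) ℓ} (P? : Decidable P) {x : Fin n} →
                   P x → x ∈ comprehension P?
∈-comprehension⁺ P? {x} px =
  lookup⇒[]= x _ (trans (lookup∘tabulate (does ∘ P?) x) (dec-true (P? x) px))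

injective⇒∣∣≤ : {S : Subset n} (f : Fin m → Fin n) → Injective _≡_ _≡_ f →
                (∀ i → f i ∈ S) → m ≤ ∣ S ∣
injective⇒∣∣≤ f f-injective f∈S = injective⇒≤ {f = λ i → index (f∈S i)}
  λ {i} {j} eq → f-injective (index-injective (f∈S i) (f∈S j) eq)

∣∣≤1⇒unique : {S : Subset n} → ∣ S ∣ ≤ 1 → ∀ {x y} → x ∈ S → y ∈ S → x ≡ y
∣∣≤1⇒unique ∣S∣≤1 x∈S y∈S = index-injective x∈S y∈S (Fin-unique ∣S∣≤1 _ _)
  where
  Fin-unique : n ≤ 1 → (i j : Fin n) → i ≡ j
  Fin-unique {suc zero} _ zero zero = refl
  Fin-unique {suc (suc _)} 2≤1 _ _ = contradiction (s≤s⁻¹ 2≤1) λ ()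

unique⇒∣∣≡1 : {S : Subset n} {x : Fin n} → x ∈ S → (∀ {y} → y ∈ S → y ≡ x) → ∣ S ∣ ≡ 1
unique⇒∣∣≡1 {S = S} {x} x∈S unique = ≤-antisym
  (≤-trans (p⊆q⇒∣p∣≤∣q∣ λ y∈S → subst (_∈ ⁅ x ⁆) (sym (unique y∈S)) (x∈⁅x⁆ x))
           (≤-reflexive (∣⁅x⁆∣≡1 x)))
  (injective⇒∣∣≤ {m = 1} (λ _ → x) (λ { {zero} {zero} _ → refl }) (λ _ → x∈S))

∣∁⁅x⁆∣<n : (x : Fin n) → ∣ ∁ ⁅ x ⁆ ∣ < n
∣∁⁅x⁆∣<n {n} x = subst (∣ ∁ ⁅ x ⁆ ∣ <_) (∣⊤∣≡n n)
  (p⊂q⇒∣p∣<∣q∣ ((λ _ → ∈⊤) , x , ∈⊤ , x∈p⇒x∉∁p (x∈⁅x⁆ x)))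

-- Counting disjoint unions, and sums bounded termwise.

pair : (f : Fin n → ℕ) → Σ (Fin n) (Fin ∘ f) → Fin (sum (tabulate f))
pair {suc n} f (zero  , a) = a ↑ˡ sum (tabulate (f ∘ suc))
pair {suc n} f (suc i , a) = f zero ↑ʳ pair (f ∘ suc) (i , a)

unpair : (f : Fin n → ℕ) → Fin (sum (tabulate f)) → Σ (Fin n) (Fin ∘ f)
unpair {suc n} f k with splitAt (f zero) k
... | inj₁ a = zero , a
... | inj₂ b = let i , a = unpair (f ∘ suc) b in suc i , a

-- Makes `unpair` injective, so that a map out of a disjoint union of finite sets can be counted by
-- a sum.
pair-unpair : (f : Fin n → ℕ) (k : Fin (sum (tabulate f))) → pair f (unpair f k) ≡ k
pair-unpair {suc n} f k
  with splitAt (f zero) k | join-splitAt (f zero) (sum (tabulate (f ∘ suc))) k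
... | inj₁ a | eq = eq
... | inj₂ b | eq = trans (cong (f zero ↑ʳ_) (pair-unpair (f ∘ suc) b)) eq

injective⇒sum≤∣∣ : (f : Fin n → ℕ) {S : Subset m} (g : Σ (Fin n) (Fin ∘ f) → Fin m) →
                   Injective _≡_ _≡_ g → (∀ p → g p ∈ S) → sum (tabulate f) ≤ ∣ S ∣
injective⇒sum≤∣∣ f g g-injective g∈S = injective⇒∣∣≤ (g ∘ unpair f)
  (λ {i} {j} eq → trans (sym (pair-unpair f i))
                        (trans (cong (pair f) (g-injective eq)) (pair-unpair f j)))
  (g∈S ∘ unpair f)

n*r≤sum : (f : Fin n → ℕ) {r : ℕ} → (∀ i → r ≤ f i) → n * r ≤ sum (tabulate f)
n*r≤sum {zero}  f r≤f = z≤n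
n*r≤sum {suc n} f r≤f = +-mono-≤ (r≤f zero) (n*r≤sum (f ∘ suc) (r≤f ∘ suc))

-- Replacing all terms but one by their lower bound `r` and cancelling leaves at most `r` for the
-- remaining term.
sum≤n*r⇒≡r : (f : Fin n → ℕ) {r : ℕ} → (∀ i → r ≤ f i) →
             sum (tabulate f) ≤ n * r → ∀ i → f i ≡ r
sum≤n*r⇒≡r {suc n} f {r} r≤f sum≤ zero = ≤-antisym
  (+-cancelʳ-≤ (n * r) (f zero) r
    (≤-trans (+-monoʳ-≤ (f zero) (n*r≤sum (f ∘ suc) (r≤f ∘ suc))) sum≤))
  (r≤f zero)
sum≤n*r⇒≡r {suc n} f {r} r≤f sum≤ (suc i) = sum≤n*r⇒≡r (f ∘ suc) (r≤f ∘ suc)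
  (+-cancelˡ-≤ r _ _ (≤-trans (+-monoˡ-≤ _ (r≤f zero)) sum≤)) i

-- Graphs and induced embeddings

Joins-ends : (G : Graph) (e : E G) {a b c d : V G} → Joins G e a b → Joins G e c d →
             (a ≡ c × b ≡ d) ⊎ (a ≡ d × b ≡ c)
Joins-ends G e (inj₁ (refl , refl)) (inj₁ (refl , refl)) = inj₁ (refl , refl)
Joins-ends G e (inj₁ (refl , refl)) (inj₂ (refl , refl)) = inj₂ (refl , refl)
Joins-ends G e (inj₂ (refl , refl)) (inj₁ (refl , refl)) = inj₂ (refl , refl)
Joins-ends G e (inj₂ (refl , refl)) (inj₂ (refl , refl)) = inj₁ (refl , refl)

Joins⇒≢ : (G : Graph) (e : E G) {a b : V G} → Joins G e a b → a ≢ b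
Joins⇒≢ G e (inj₁ (refl , refl)) a≡b = loopless G e a≡b
Joins⇒≢ G e (inj₂ (refl , refl)) a≡b = loopless G e (sym a≡b)

Joins-cancelˡ : (G : Graph) (e : E G) {a b c : V G} → Joins G e a b → Joins G e a c → b ≡ c
Joins-cancelˡ G e ab ac with Joins-ends G e ab ac
... | inj₁ (_ , b≡c)   = b≡c
... | inj₂ (a≡c , _) = contradiction a≡c (Joins⇒≢ G e ac)

Incident⇒Joins : (G : Graph) (e : E G) {a : V G} → Incident G a e → ∃ λ b → Joins G e a b
Incident⇒Joins G e (inj₁ refl) = end₂ G e , inj₁ (refl , refl)
Incident⇒Joins G e (inj₂ refl) = end₁ G e , inj₂ (refl , refl)

Joins⇒Incidentˡ : (G : Graph) (e : E G) {a b : V G} → Joins G e a b → Incident G a e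
Joins⇒Incidentˡ G e (inj₁ (refl , _)) = inj₁ refl
Joins⇒Incidentˡ G e (inj₂ (_ , refl)) = inj₂ refl

-- Induced subgraphs up to isomorphism: `full` forces every parallel edge between two image vertices
-- to be hit. Working with maps instead of subsets lets iterated induced subgraphs be compared
-- without renumbering vertices.
infix 4 _↪_
record _↪_ (K G : Graph) : Set where
  field
    onV         : V K → V G
    onE         : E K → E G
    onV-inj     : Injective _≡_ _≡_ onV
    onE-inj     : Injective _≡_ _≡_ onE
    preserves   : ∀ e {a b} → Joins K e a b → Joins G (onE e) (onV a) (onV b)
    full        : ∀ e {a b} → Joins G e (onV a) (onV b) → ∃ λ e′ → onE e′ ≡ e

  reflects : ∀ e {a b} → Joins G (onE e) (onV a) (onV b) → Joins K e a b
  reflects e j with Joins-ends G (onE e) (preserves e (inj₁ (refl , refl))) j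
  ... | inj₁ (p , q) = inj₁ (onV-inj p , onV-inj q)
  ... | inj₂ (p , q) = inj₂ (onV-inj p , onV-inj q)

open _↪_

↪-trans : L ↪ K → K ↪ G → L ↪ G
↪-trans {G = G} φ ψ = record
  { onV       = onV ψ ∘ onV φ
  ; onE       = onE ψ ∘ onE φ
  ; onV-inj   = onV-inj φ ∘ onV-inj ψ
  ; onE-inj   = onE-inj φ ∘ onE-inj ψ
  ; preserves = λ e → preserves ψ _ ∘ preserves φ e
  ; full      = λ e j →
      let e′ , p = full ψ e j
          e″ , q = full φ e′ (reflects ψ e′ (subst (λ f → Joins G f _ _) (sym p) j))
      in e″ , trans (cong (onE ψ) q) p
  }

induced : (G : Graph) (S : Subset (#V G)) → G [ S ] ↪ G
induced G S = record
  { onV       = element S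
  ; onE       = element F
  ; onV-inj   = element-injective S
  ; onE-inj   = element-injective F
  ; preserves = λ
      { e (inj₁ (refl , refl)) → inj₁ (sym (element-index _) , sym (element-index _))
      ; e (inj₂ (refl , refl)) → inj₂ (sym (element-index _) , sym (element-index _)) }
  ; full      = λ e j → let e∈F = ∈-comprehension⁺ (within? G S) (within e j)
                        in index e∈F , element-index e∈F
  }
  where
  F : Subset (#E G)
  F = comprehension (within? G S)

  within : ∀ e {i j} → Joins G e (element S i) (element S j) → Within G S e
  within e {i} {j} (inj₁ (p , q)) =
    subst (_∈ S) (sym p) (element∈ S i) , subst (_∈ S) (sym q) (element∈ S j)
  within e {i} {j} (inj₂ (p , q)) =
    subst (_∈ S) (sym p) (element∈ S j) , subst (_∈ S) (sym q) (element∈ S i)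

-- Inclusion of vertex sets suffices: `ψ` is full, so every edge in the image of `φ` is already an
-- edge of `K`. This compares subgraphs obtained by different sequences of deletions.
↪-factor : (φ : L ↪ G) (ψ : K ↪ G) → (∀ a → ∃ λ b → onV ψ b ≡ onV φ a) → L ↪ K
↪-factor {L} {G} {K} φ ψ nested = record
  { onV       = f
  ; onE       = g
  ; onV-inj   = λ {a} {b} eq → onV-inj φ
      (trans (sym (ψf≡φ a)) (trans (cong (onV ψ) eq) (ψf≡φ b)))
  ; onE-inj   = λ {a} {b} eq → onE-inj φ
      (trans (sym (ψg≡φ a)) (trans (cong (onE ψ) eq) (ψg≡φ b)))
  ; preserves = λ e {a} {b} j → reflects ψ (g e)
      (subst (λ e′ → Joins G e′ (onV ψ (f a)) (onV ψ (f b))) (sym (ψg≡φ e)) (lift e j))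
  ; full      = λ e {a} {b} j →
      let e′ , p = full φ (onE ψ e)
            (subst₂ (Joins G (onE ψ e)) (ψf≡φ a) (ψf≡φ b) (preserves ψ e j))
      in e′ , onE-inj ψ (trans (ψg≡φ e′) p)
  }
  where
  f : V L → V K
  f a = proj₁ (nested a)

  ψf≡φ : ∀ a → onV ψ (f a) ≡ onV φ a
  ψf≡φ a = proj₂ (nested a)

  lift : ∀ e {a b} → Joins L e a b → Joins G (onE φ e) (onV ψ (f a)) (onV ψ (f b))
  lift e {a} {b} j =
    subst₂ (Joins G (onE φ e)) (sym (ψf≡φ a)) (sym (ψf≡φ b)) (preserves φ e j)

  g : E L → E K
  g e = proj₁ (full ψ (onE φ e) (lift e (inj₁ (refl , refl))))

  ψg≡φ : ∀ e → onE ψ (g e) ≡ onE φ e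
  ψg≡φ e = proj₂ (full ψ (onE φ e) (lift e (inj₁ (refl , refl))))

surjective-↪⇒≅ : (φ : K ↪ G) → (∀ b → ∃ λ a → onV φ a ≡ b) → K ≅ G
surjective-↪⇒≅ {K} {G} φ onto = record
  { onV       = bijection (onV φ) (onV-inj φ) onto
  ; onE       = bijection (onE φ) (onE-inj φ) onto-E
  ; preserves = λ e _ _ → preserves φ e
  }
  where
  bijection : {A B : Set} (f : A → B) → Injective _≡_ _≡_ f → (∀ b → ∃ λ a → f a ≡ b) → A ↔ B
  bijection f f-inj f-onto = mk↔ₛ′ f (proj₁ ∘ f-onto) (proj₂ ∘ f-onto)
    (λ a → f-inj (proj₂ (f-onto (f a))))

  onto-E : ∀ e → ∃ λ e′ → onE φ e′ ≡ e
  onto-E e = full φ e (inj₁ (sym (proj₂ (onto _)) , sym (proj₂ (onto _))))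

-- `Hereditary` speaks of `G [ S ]` only. With `S` the vertex image of `φ`, that graph is isomorphic
-- to `K`, and `P` is closed under isomorphism.
↪-hereditary : (P : GraphProperty ℓ) → Hereditary P → K ↪ G → G ∈ᵖ P → K ∈ᵖ P
↪-hereditary {K = K} {G} P hereditary φ G∈P =
  GraphProperty.≅-closed P (surjective-↪⇒≅ ι onto) (hereditary G S G∈P)
  where
  inImage? : Decidable (λ b → ∃ λ a → onV φ a ≡ b)
  inImage? b = any? λ a → onV φ a ≟ b

  S : Subset (#V G)
  S = comprehension inImage?

  nested : ∀ i → ∃ λ a → onV φ a ≡ element S i
  nested i = ∈-comprehension⁻ inImage? (element∈ S i)

  ι : G [ S ] ↪ K
  ι = ↪-factor (induced G S) φ nested

  onto : ∀ a → ∃ λ i → onV ι i ≡ a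
  onto a = index a∈S , onV-inj φ (trans (proj₂ (nested (index a∈S))) (element-index a∈S))
    where
    a∈S : onV φ a ∈ S
    a∈S = ∈-comprehension⁺ inImage? (a , refl)

-- Degrees and minimal induced subgraphs outside a property.

deg-mono : (φ : K ↪ G) (a : V K) → deg K a ≤ deg G (onV φ a)
deg-mono {K} {G} φ a = injective⇒∣∣≤ (onE φ ∘ element F)
  (element-injective F ∘ onE-inj φ)
  λ i → let j = proj₂ (Incident⇒Joins K _ (∈-comprehension⁻ (incident? K a) (element∈ F i)))
        in ∈-comprehension⁺ (incident? G _) (Joins⇒Incidentˡ G _ (preserves φ _ j))
  where
  F : Subset (#E K)
  F = comprehension (incident? K a)

minDegree : (G : Graph) → V G → ∃ (IsMinDegree G)
minDegree G v = deg G w , (w , refl) , λ { _ (u , refl) →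
  -- The given vertex `v` shows that the graph is non-empty and serves as the default value of
  -- `argmin`.
  All.lookup (f[argmin]≤f[xs] {f = deg G} v (allFin (#V G))) (∈-allFin u) }
  where
  w : V G
  w = argmin (deg G) v (allFin (#V G))

≢⇒∈∁ : {x y : Fin n} → x ≢ y → x ∈ ∁ ⁅ y ⁆
≢⇒∈∁ x≢y = x∉p⇒x∈∁p (x≢y⇒x∉⁅y⁆ x≢y)

∈∁⇒≢ : {x y : Fin n} → x ∈ ∁ ⁅ y ⁆ → x ≢ y
∈∁⇒≢ x∈∁ refl = x∈∁p⇒x∉p x∈∁ (x∈⁅x⁆ _)

-- Membership in P is not decidable, so the passage to a minimal induced
-- subgraph outside P happens under a double negation, harmless here
-- because the conclusion r ≤ deg K x is stable.
r≤deg : (P : GraphProperty ℓ) → Hereditary P → {r : ℕ} → d[ P ]≔ r →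
        (K : Graph) (x : V K) → K ∉ᵖ P → K -ᵛ x ∈ᵖ P → r ≤ deg K x
r≤deg P hereditary {r} d≡r K x = go (#V K) K x ≤-refl
  where
  -- Induction on a bound for the order: either `K` is critical, or deleting some `v` other than `x`
  -- gives a smaller graph outside `P` that still contains `x`.
  go : ∀ n (K : Graph) (x : V K) → #V K ≤ n → K ∉ᵖ P → K -ᵛ x ∈ᵖ P → r ≤ deg K x
  go zero    K x #V≤0 = contradiction (≤-trans (∣∁⁅x⁆∣<n x) #V≤0) λ ()
  go (suc n) K x #V≤n K∉P K-x∈P = ≮⇒≥ λ deg<r →
    -- As there are finitely many vertices, the double negations of `K -ᵛ v ∈ᵖ P` combine into one
    -- for all `v` at once. Then `K` is in `CR P`, so its minimum degree is at least `r`.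
    sequence (RawMonad.rawApplicative ¬¬-Monad) (K-v∈P deg<r) λ K-∈P →
      let k , isMin = minDegree K x
      in ≤⇒≯ (≤-trans (proj₂ d≡r k (K , (K∉P , K-∈P) , isMin)) (proj₂ isMin _ (x , refl))) deg<r
    where
    K-v∈P : deg K x < r → ∀ v → ¬ (K -ᵛ v ∉ᵖ P)
    K-v∈P deg<r v K-v∉P with x ≟ v
    ... | yes refl = K-v∉P K-x∈P
    ... | no x≢v   = ≤⇒≯ (≤-trans r≤ deg≤) deg<r
      where
      x∈ : x ∈ ∁ ⁅ v ⁆
      x∈ = ≢⇒∈∁ x≢v

      ι : K -ᵛ v ↪ K
      ι = induced K (∁ ⁅ v ⁆)

      -- `(K - v) - x` lies inside `K - x`, so it inherits `P` and the induction hypothesis applies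
      -- to `K - v`.
      nested : ∀ i → ∃ λ j → element (∁ ⁅ x ⁆) j ≡
                             element (∁ ⁅ v ⁆) (element (∁ ⁅ index x∈ ⁆) i)
      nested i = index y∈ , element-index y∈
        where
        y∈ : element (∁ ⁅ v ⁆) (element (∁ ⁅ index x∈ ⁆) i) ∈ ∁ ⁅ x ⁆
        y∈ = ≢⇒∈∁ λ y≡x → ∈∁⇒≢ (element∈ (∁ ⁅ index x∈ ⁆) i)
               (element-injective (∁ ⁅ v ⁆) (trans y≡x (sym (element-index x∈))))

      r≤ : r ≤ deg (K -ᵛ v) (index x∈)
      r≤ = go n (K -ᵛ v) (index x∈) (s≤s⁻¹ (≤-trans (∣∁⁅x⁆∣<n v) #V≤n)) K-v∉P
        (↪-hereditary P hereditary
          (↪-factor (↪-trans (induced (K -ᵛ v) (∁ ⁅ index x∈ ⁆)) ι)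
                    (induced K (∁ ⁅ x ⁆)) nested)
          K-x∈P)

      deg≤ : deg (K -ᵛ v) (index x∈) ≤ deg K x
      deg≤ = subst (λ y → deg (K -ᵛ v) (index x∈) ≤ deg K y) (element-index x∈)
                   (deg-mono ι (index x∈))

-- Covers

module PartialTransversal (C : Cover G) {v : V G} {T : Subset (#V (H C))}
  (partial : IsPartialTransversal C T) (dom≡ : dom C T ≡ ∁ ⁅ v ⁆) where

  unique : ∀ u {x y} → x ∈ T → x ∈ X C u → y ∈ T → y ∈ X C u → x ≡ y
  unique u x∈T x∈X y∈T y∈X =
    ∣∣≤1⇒unique (partial u) (x∈p∩q⁺ (x∈T , x∈X)) (x∈p∩q⁺ (y∈T , y∈X))

  avoids : ∀ {x} → x ∈ T → x ∉ X C v
  avoids {x} x∈T x∈X = ∈∁⇒≢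
    (subst (v ∈_) dom≡
      (∈-comprehension⁺ (λ u → nonempty? (X C u ∩ T)) (x , x∈p∩q⁺ (x∈X , x∈T))))
    refl

  meets : ∀ {u} → u ≢ v → ∃ λ x → x ∈ T × x ∈ X C u
  meets {u} u≢v =
    let x , x∈ = ∈-comprehension⁻ (λ w → nonempty? (X C w ∩ T))
                   (subst (u ∈_) (sym dom≡) (≢⇒∈∁ u≢v))
        x∈X , x∈T = x∈p∩q⁻ (X C u) T x∈
    in x , x∈T , x∈X

  -- `T` misses `X C v` and meets every other class once; `x` fills the gap and, by disjointness,
  -- enters no other class.
  ∪⁅x⁆-isTransversal : ∀ {x} → x ∈ X C v → IsTransversal C (T ∪ ⁅ x ⁆)
  ∪⁅x⁆-isTransversal {x} x∈Xv u with u ≟ v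
  ... | yes refl = unique⇒∣∣≡1 (x∈p∩q⁺ (x∈p∪q⁺ (inj₂ (x∈⁅x⁆ x)) , x∈Xv)) λ y∈ →
    let y∈T∪x , y∈X = x∈p∩q⁻ (T ∪ ⁅ x ⁆) (X C v) y∈
    in [ (λ y∈T → contradiction y∈X (avoids y∈T)) , x∈⁅y⁆⇒x≡y x ]′ (x∈p∪q⁻ T ⁅ x ⁆ y∈T∪x)
  ... | no u≢v = let z , z∈T , z∈X = meets u≢v in
    unique⇒∣∣≡1 (x∈p∩q⁺ (x∈p∪q⁺ (inj₁ z∈T) , z∈X)) λ y∈ →
    let y∈T∪x , y∈X = x∈p∩q⁻ (T ∪ ⁅ x ⁆) (X C u) y∈
    in [ (λ y∈T → unique u y∈T y∈X z∈T z∈X)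
       , (λ y∈x → contradiction
            (x , x∈p∩q⁺ (subst (_∈ X C u) (x∈⁅y⁆⇒x≡y x y∈x) y∈X , x∈Xv))
            (disjoint C u v u≢v))
       ]′ (x∈p∪q⁻ T ⁅ x ⁆ y∈T∪x)

  -- The graph induced by `T ∪ ⁅ x ⁆` is outside `P` since a critical cover has no `P`-transversal;
  -- deleting `x` from it leaves a subgraph of `H C [ T ]`, so `r≤deg` applies.
  r≤degWith : (P : GraphProperty ℓ) → Hereditary P → {r : ℕ} → d[ P ]≔ r →
              IsCritical C P → H C [ T ] ∈ᵖ P → ∀ {x} → x ∈ X C v → r ≤ degWith C T x
  r≤degWith P hereditary d≡r critical T∈P {x} x∈Xv =
    r≤deg P hereditary d≡r (H C [ T ∪ ⁅ x ⁆ ]) i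
      (λ ∈P → proj₁ critical (T ∪ ⁅ x ⁆ , ∪⁅x⁆-isTransversal x∈Xv , ∈P))
      (↪-hereditary P hereditary
        (↪-factor (↪-trans (induced _ (∁ ⁅ i ⁆)) (induced (H C) (T ∪ ⁅ x ⁆)))
                  (induced (H C) T) nested)
        T∈P)
    where
    x∈ : x ∈ T ∪ ⁅ x ⁆
    x∈ = q⊆p∪q T ⁅ x ⁆ (x∈⁅x⁆ x)

    i : Fin ∣ T ∪ ⁅ x ⁆ ∣
    i = index x∈

    nested : ∀ k → ∃ λ j → element T j ≡ element (T ∪ ⁅ x ⁆) (element (∁ ⁅ i ⁆) k)
    nested k with x∈p∪q⁻ T ⁅ x ⁆ (element∈ (T ∪ ⁅ x ⁆) (element (∁ ⁅ i ⁆) k))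
    ... | inj₁ y∈T = index y∈T , element-index y∈T
    ... | inj₂ y∈x = contradiction
      (element-injective (T ∪ ⁅ x ⁆) (trans (x∈⁅y⁆⇒x≡y x y∈x) (sym (element-index x∈))))
      (∈∁⇒≢ (element∈ (∁ ⁅ i ⁆) k))

  -- The upper bound: charging edges of the cover to edges of `G` at `v`.

  record Slot (e : E (H C)) : Set where
    field
      {u}    : V G
      v≢u    : v ≢ u
      {y}    : V (H C)
      y∈T    : y ∈ T
      y∈X    : y ∈ X C u
      y∼e    : Incident (H C) y e
      -- `μ G v u` counts both the matchings between the two classes and the edges joining `v` and
      -- `u`, so the index of a matching containing `e` also selects the edge of `G` to which `e` is
      -- charged.
      i      : Fin (μ G v u)
      e∈M    : e ∈ proj₁ (matchings C v u v≢u) i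

    edge : E G
    edge = element (comprehension (joins? G v u)) i

    edge-joins : Joins G edge v u
    edge-joins = ∈-comprehension⁻ (joins? G v u) (element∈ (comprehension (joins? G v u)) i)

  slot : ∀ {e x y} → x ∈ X C v → y ∈ T → Joins (H C) e x y → Slot e
  slot {e} {x} {y} x∈X y∈T xy = record
    { v≢u = v≢u
    ; y∈T = y∈T
    ; y∈X = y∈X
    ; y∼e = Joins⇒Incidentˡ (H C) e (swap xy)
    ; e∈M = proj₂ i,e∈M
    }
    where
    u : V G
    u = proj₁ (covering C y)

    y∈X : y ∈ X C u
    y∈X = proj₂ (covering C y)

    v≢u : v ≢ u
    v≢u v≡u = avoids y∈T (subst (λ w → y ∈ X C w) (sym v≡u) y∈X)

    i,e∈M = Equivalence.to (proj₂ (proj₂ (matchings C v u v≢u)) e) (x , y , x∈X , y∈X , xy)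

  -- The matchings depend on the proof of v ≢ u, but any two such proofs are
  -- definitionally equal, ⊥ being proof-irrelevant.
  edge-injective : ∀ {e f} (s : Slot e) (t : Slot f) → Slot.edge s ≡ Slot.edge t → e ≡ f
  -- Both charged edges have `v` as an end, so if they coincide, their other ends do too.
  edge-injective s t eq = go s t eq (Joins-cancelˡ G (Slot.edge s) (Slot.edge-joins s)
      (subst (λ e → Joins G e v (Slot.u t)) (sym eq) (Slot.edge-joins t)))
    where
    go : ∀ {e f} (s : Slot e) (t : Slot f) → Slot.edge s ≡ Slot.edge t → Slot.u s ≡ Slot.u t → e ≡ f
    go {e} {f} s t eq refl with element-injective (comprehension (joins? G v (Slot.u s))) eq
    -- Now `e` and `f` lie in the same matching and share the only vertex of `T` in that class,
    -- hence are equal.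
    ... | refl = proj₁ (proj₂ (matchings C v (Slot.u s) (Slot.v≢u s))) (Slot.i s) (Slot.y s)
      (Slot.e∈M s) (Slot.e∈M t) (Slot.y∼e s)
      (subst (λ y → Incident (H C) y f)
             (unique (Slot.u s) (Slot.y∈T t) (Slot.y∈X t) (Slot.y∈T s) (Slot.y∈X s))
             (Slot.y∼e t))

  -- The edges counted by degWith C T x, as edges of H.
  module Spokes (x : V (H C)) where

    S : Subset (#V (H C))
    S = T ∪ ⁅ x ⁆

    x∈S : x ∈ S
    x∈S = q⊆p∪q T ⁅ x ⁆ (x∈⁅x⁆ x)

    ι : H C [ S ] ↪ H C
    ι = induced (H C) S

    F : Subset (#E (H C [ S ]))
    F = comprehension (incident? (H C [ S ]) (index x∈S))

    spoke : Fin (degWith C T x) → E (H C)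
    spoke k = onE ι (element F k)

    spoke-injective : Injective _≡_ _≡_ spoke
    spoke-injective = element-injective F ∘ onE-inj ι

    spoke-joins : ∀ k → ∃ λ y → y ∈ T × Joins (H C) (spoke k) x y
    spoke-joins k = y , y∈T , xy
      where
      neighbour : ∃ λ j → Joins (H C [ S ]) (element F k) (index x∈S) j
      neighbour = Incident⇒Joins (H C [ S ]) (element F k)
        (∈-comprehension⁻ (incident? (H C [ S ]) (index x∈S)) (element∈ F k))

      y : V (H C)
      y = element S (proj₁ neighbour)

      xy : Joins (H C) (spoke k) x y
      xy = subst (λ z → Joins (H C) (spoke k) z y) (element-index x∈S)
                 (preserves ι (element F k) (proj₂ neighbour))

      y∈T : y ∈ T
      y∈T = [ (λ y∈T → y∈T)
            , (λ y∈x → contradiction (sym (x∈⁅y⁆⇒x≡y x y∈x)) (Joins⇒≢ (H C) (spoke k) xy))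
            ]′ (x∈p∪q⁻ T ⁅ x ⁆ (element∈ S (proj₁ neighbour)))

  open Spokes using (spoke; spoke-injective; spoke-joins)

  -- `T` avoids `X C v`, so the end of `e` in that class cannot be the end in `T`.
  source-unique : ∀ e {x x′ y y′} → x ∈ X C v → y′ ∈ T →
                  Joins (H C) e x y → Joins (H C) e x′ y′ → x ≡ x′
  source-unique e x∈X y′∈T xy x′y′ with Joins-ends (H C) e xy x′y′
  ... | inj₁ (x≡x′ , _) = x≡x′
  ... | inj₂ (x≡y′ , _) = contradiction (subst (_∈ X C v) x≡y′ x∈X) (avoids y′∈T)

  spoke-source : ∀ {x x′} k k′ → x ∈ X C v → spoke x k ≡ spoke x′ k′ → x ≡ x′
  spoke-source {x} {x′} k k′ x∈X eq =
    let y  , _    , xy   = spoke-joins x k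
        y′ , y′∈T , x′y′ = spoke-joins x′ k′
    in source-unique (spoke x′ k′) x∈X y′∈T (subst (λ e → Joins (H C) e x y) eq xy) x′y′

  -- Pairs of a vertex of `X C v` and a spoke at it map injectively to edges of `H`, and these
  -- injectively to edges of `G` at `v` through their slots.
  ∑degWith≤deg : ∑ (X C v) (degWith C T) ≤ deg G v
  ∑degWith≤deg = injective⇒sum≤∣∣ (degWith C T ∘ element (X C v)) (Slot.edge ∘ slotOf)
    (λ {p} {q} eq → edgeOf-injective p q (edge-injective (slotOf p) (slotOf q) eq))
    (λ p → ∈-comprehension⁺ (incident? G v)
             (Joins⇒Incidentˡ G (Slot.edge (slotOf p)) (Slot.edge-joins (slotOf p))))
    where
    Spoke : Set
    Spoke = Σ (Fin ∣ X C v ∣) (Fin ∘ degWith C T ∘ element (X C v))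

    edgeOf : Spoke → E (H C)
    edgeOf (j , k) = spoke (element (X C v) j) k

    slotOf : (p : Spoke) → Slot (edgeOf p)
    slotOf (j , k) = let _ , y∈T , xy = spoke-joins (element (X C v) j) k
                     in slot (element∈ (X C v) j) y∈T xy

    edgeOf-injective : ∀ p q → edgeOf p ≡ edgeOf q → p ≡ q
    edgeOf-injective (j , k) (j′ , k′) eq = go k′ eq
      (element-injective (X C v) (spoke-source k k′ (element∈ (X C v) j) eq))
      where
      -- The type of the second spoke index depends on the first component, so the latter is
      -- generalised to `i` before `j ≡ i` is matched with `refl`.
      go : ∀ {i} (l : Fin (degWith C T (element (X C v) i))) →
           spoke (element (X C v) j) k ≡ spoke (element (X C v) i) l → j ≡ i → (j , k) ≡ (i , l)
      go l eq refl = cong (j ,_) (spoke-injective (element (X C v) j) eq)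

-- Comparison of the two bounds.

proposition3 : {ℓ : Level} (P : GraphProperty ℓ) → Reliable P →
    (r : ℕ) → d[ P ]≔ r →
    (G : Graph) (C : Cover G) → IsCritical C P →
    ((v : V G) → deg G v ≥ r * ∣ X C v ∣)
    ×
    ((v : V G) → deg G v ≡ r * ∣ X C v ∣ →
    (T : Subset (#V (H C))) → IsTransversalForAvoiding C P v T →
    ((x : V (H C)) → x ∈ X C v → degWith C T x ≡ r)
    × deg G v ≡ ∑ (X C v) (degWith C T))
proposition3 P reliable r d≡r G C critical = partA , partB
  where
  r≤ : ∀ v T → IsTransversalForAvoiding C P v T →
       ∀ j → r ≤ degWith C T (element (X C v) j)
  r≤ v T (partial , dom≡ , T∈P) j = PartialTransversal.r≤degWith C partial dom≡
    P (Reliable.hereditary reliable) d≡r critical T∈P (element∈ (X C v) j)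

  ∑≤deg : ∀ v T → IsTransversalForAvoiding C P v T → ∑ (X C v) (degWith C T) ≤ deg G v
  ∑≤deg v T (partial , dom≡ , _) = PartialTransversal.∑degWith≤deg C partial dom≡

  r*∣X∣≤∑ : ∀ v T → IsTransversalForAvoiding C P v T →
            r * ∣ X C v ∣ ≤ ∑ (X C v) (degWith C T)
  r*∣X∣≤∑ v T t = ≤-trans (≤-reflexive (*-comm r ∣ X C v ∣)) (n*r≤sum _ (r≤ v T t))

  partA : ∀ v → deg G v ≥ r * ∣ X C v ∣
  -- Criticality supplies the `T` through which the two bounds are chained.
  partA v = let T , t = proj₂ critical v in ≤-trans (r*∣X∣≤∑ v T t) (∑≤deg v T t)

  partB : ∀ v → deg G v ≡ r * ∣ X C v ∣ → ∀ T → IsTransversalForAvoiding C P v T →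
          (∀ x → x ∈ X C v → degWith C T x ≡ r) × deg G v ≡ ∑ (X C v) (degWith C T)
  partB v deg≡ T t =
    (λ x x∈X → subst (λ y → degWith C T y ≡ r) (element-index x∈X) (d≡ (index x∈X))) ,
    ≤-antisym (≤-trans (≤-reflexive deg≡) (r*∣X∣≤∑ v T t)) (∑≤deg v T t)
    where
    d≡ : ∀ j → degWith C T (element (X C v) j) ≡ r
    -- The degree hypothesis closes the chain of inequalities, so no term of the sum can exceed `r`.
    d≡ = sum≤n*r⇒≡r (degWith C T ∘ element (X C v)) (r≤ v T t)
      (≤-trans (∑≤deg v T t) (≤-reflexive (trans deg≡ (*-comm r ∣ X C v ∣))))
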